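{- Let $D_1$ and $D_2$ be oriented graphs such that $\operatorname{inv}(D_1)=2$ and $\operatorname{inv}(D_2)=k$. Then either (i) $\operatorname{inv}(D_1\rightarrow D_2)=k+2$; or (ii) $\operatorname{inv}(D_1\rightarrow D_2)=k+1$, in which case $k$ is odd. Moreover, $\operatorname{inv}(D_1\rightarrow D_2)=k+1$ if and only if $\operatorname{inv}(\overrightarrow{C_3}\rightarrow D_2)=k$.
   Context: An oriented graph is a finite simple oriented graph: no loops and at most one arc between any two vertices. For an oriented graph $D$ and $X\subseteq V(D)$, the inversion of $X$ in $D$ is the oriented graph obtained by reversing the orientation of every arc with both ends in $X$. A family $X_1,\dots,X_m$ of subsets of $V(D)$ is a decycling family for $D$ if successively inverting all of $X_1,\dots,X_m$ (the order does not matter) yields an oriented graph with no directed cycle. The inversion number $\operatorname{inv}(D)$ is the smallest integer $m\ge 0$ for which there is a decycling family of $m$ sets for $D$. The dijoin $D_1\rightarrow D_2$ is the oriented graph obtained from the disjoint union of $D_1$ and $D_2$ by adding an arc from $u$ to $v$ for every $u\in V(D_1)$ and $v\in V(D_2)$. $\overrightarrow{C_3}$ denotes the directed cycle on 3 vertices. -}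

module Defs where

open import Data.Bool using (Bool; true; false; T; _∧_; if_then_else_)
open import Data.Bool.Properties using (∧-comm)
open import Data.Fin using (Fin; zero; suc; inject₁; fromℕ; splitAt)
open import Data.Fin.Subset using (Subset)
open import Data.Nat using (ℕ; suc; _+_; _≤_)
open import Data.Product using (∃-syntax; _×_)
open import Data.Sum using (_⊎_; inj₁; inj₂)
open import Data.Vec using (Vec; lookup; foldl′)
open import Function.Definitions using (Injective)
open import Level using (0ℓ)
open import Relation.Binary using (Rel; Asymmetric)
open import Relation.Binary.PropositionalEquality using (_≡_)
open import Relation.Nullary using (¬_)

-- Asymmetry of the arc relation excludes loops as well as pairs of
-- opposite arcs.
record OrientedGraph (n : ℕ) : Set where
  field
    arc : Fin n → Fin n → Bool

  Arc : Rel (Fin n) 0ℓ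
  Arc u v = T (arc u v)

  field
    asym : Asymmetric Arc

open OrientedGraph public

-- A directed cycle on suc ℓ distinct vertices.  Cycles of length 1 and 2
-- are not excluded here, but asymmetry rules them out.
record DirectedCycle {n : ℕ} (D : OrientedGraph n) : Set where
  field
    ℓ         : ℕ
    vertex    : Fin (suc ℓ) → Fin n
    injective : Injective _≡_ _≡_ vertex
    step      : ∀ i → Arc D (vertex (inject₁ i)) (vertex (suc i))
    close     : Arc D (vertex (fromℕ ℓ)) (vertex zero)

Acyclic : ∀ {n} → OrientedGraph n → Set
Acyclic D = ¬ DirectedCycle D

-- A Subset is a vector of Booleans, so lookup X u decides u ∈ X.
invert : ∀ {n} → OrientedGraph n → Subset n → OrientedGraph n
invert {n} D X = record { arc = arc′ ; asym = λ {u} {v} → asym′ u v }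
  where
  arc′ : Fin n → Fin n → Bool
  arc′ u v = if lookup X u ∧ lookup X v then arc D v u else arc D u v

  asym′ : ∀ u v → T (arc′ u v) → ¬ T (arc′ v u)
  asym′ u v rewrite ∧-comm (lookup X v) (lookup X u)
    with lookup X u ∧ lookup X v
  ... | true  = asym D
  ... | false = asym D

invertAll : ∀ {n m} → OrientedGraph n → Vec (Subset n) m → OrientedGraph n
invertAll = foldl′ invert

Decycling : ∀ {n m} → OrientedGraph n → Vec (Subset n) m → Set
Decycling D Xs = Acyclic (invertAll D Xs)

-- inv(D) = m, as a relation: m is the least size of a decycling family.
-- Families are sequences, so repeated sets are allowed.
Inv_≔_ : ∀ {n} → OrientedGraph n → ℕ → Set
Inv_≔_ {n} D m =
    (∃[ Xs ] Decycling {n} {m} D Xs)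
  × (∀ m′ (Xs : Vec (Subset n) m′) → Decycling D Xs → m ≤ m′)

infix 4 Inv_≔_

-- The vertices of D₁ ⇒ D₂ are those of D₁ followed by those of D₂.
infixr 5 _⇒_

_⇒_ : ∀ {n₁ n₂} → OrientedGraph n₁ → OrientedGraph n₂ → OrientedGraph (n₁ + n₂)
_⇒_ {n₁} {n₂} D₁ D₂ = record
  { arc  = λ u v → arc⊎ (splitAt n₁ u) (splitAt n₁ v)
  ; asym = λ {u} {v} → asym⊎ (splitAt n₁ u) (splitAt n₁ v)
  }
  where
  arc⊎ : Fin n₁ ⊎ Fin n₂ → Fin n₁ ⊎ Fin n₂ → Bool
  arc⊎ (inj₁ u) (inj₁ v) = arc D₁ u v
  arc⊎ (inj₁ _) (inj₂ _) = true
  arc⊎ (inj₂ _) (inj₁ _) = false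
  arc⊎ (inj₂ u) (inj₂ v) = arc D₂ u v

  asym⊎ : ∀ x y → T (arc⊎ x y) → ¬ T (arc⊎ y x)
  asym⊎ (inj₁ _) (inj₁ _) = asym D₁
  asym⊎ (inj₁ _) (inj₂ _) _ ()
  asym⊎ (inj₂ _) (inj₁ _) ()
  asym⊎ (inj₂ _) (inj₂ _) = asym D₂

C⃗₃ : OrientedGraph 3
C⃗₃ = record { arc = arc₃ ; asym = λ {u} {v} → asym₃ u v }
  where
  arc₃ : Fin 3 → Fin 3 → Bool
  arc₃ zero             (suc zero)       = true
  arc₃ (suc zero)       (suc (suc zero)) = true
  arc₃ (suc (suc zero)) zero             = true
  arc₃ _                _                = false

  asym₃ : ∀ u v → T (arc₃ u v) → ¬ T (arc₃ v u)
  asym₃ zero             (suc zero)       _ ()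
  asym₃ (suc zero)       (suc (suc zero)) _ ()
  asym₃ (suc (suc zero)) zero             _ ()

{-# OPTIONS --safe #-}
-- A family of m sets is the same as a vector x_v ∈ 𝔽₂^m for every vertex v, and
-- it reverses the arc between u and v exactly when x_u · x_v = 1; so inv(D) ≤ m
-- if and only if reversing along some Gram matrix in dimension m makes D acyclic.
--
-- Take such vectors for D₁ ⇒ D₂ and a final linear order.  For a ∈ V(D₁) the
-- vertices v of D₂ with a · v = 1 are those placed before a, hence form an initial
-- segment of D₂.  Reversing a block of an acyclic order keeps it acyclic, so
-- the form on D₂ may be changed by any symmetric form on the span of a, b ∈ V(D₁).
-- As inv(D₁) > 1, the Gram matrix of D₁ does not have rank at most 1, so some a, b
-- span a nondegenerate plane, and D₂ can be projected onto its complement.  This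
-- complement is isometric to 𝔽₂^(m - 2), giving k ≤ m - 2, unless the form on it is
-- alternating; then D₂ lives in the even vectors of 𝔽₂^(m - 1) with m - 1 odd, and
-- all-ones vectors, orthogonal to these, decycle C₃.  Conversely, the same argument
-- with one a ∈ V(C₃) shows that a family of k sets for C₃ ⇒ D₂ gives even
-- vectors in odd dimension k for D₂, whose complement in 𝔽₂^(k + 1) contains two
-- orthonormal vectors, enough for D₁.
module Submission where

open import Defs
open import Algebra.Bundles using (CommutativeRing)
import Algebra.Properties.CommutativeMonoid.Sum as FiniteSum
open import Data.Bool using (Bool; true; false; T; _∧_; _xor_; if_then_else_; _≟_)
open import Data.Bool.Properties 
  using (T?; ¬-not; ∧-comm; ∧-idem; ∧-identityʳ; ∧-zeroʳ; xor-comm; xor-same; xor-identityʳ; xor-∧-commutativeRing)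
open import Data.Bool.Solver using (module xor-∧-Solver)
open import Data.Empty using (⊥-elim)
open import Data.Fin as Fin
  using (Fin; zero; suc; toℕ; inject₁; inject≤; fromℕ; splitAt; _↑ˡ_; _↑ʳ_; opposite; combine; punchIn; punchOut)
open import Data.Fin.Properties as Finₚ using (any?)
open import Data.Fin.Subset using (Subset)
open import Data.Fin.Subset.Properties using (anySubset?)
open import Data.Nat as ℕ using (ℕ; zero; suc; _+_; _%_; s≤s; z≤n)
import Data.Nat.Properties as ℕₚ
open import Data.Product using (Σ-syntax; ∃-syntax; _×_; _,_; proj₁; proj₂; uncurry)
open import Data.Sum as Sum using (_⊎_; inj₁; inj₂; [_,_])
open import Data.Vec using (Vec; []; _∷_; lookup; tabulate)
open import Data.Vec.Functional as VF using (Vector; removeAt)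
open import Data.Vec.Properties using (lookup∘tabulate)
open import Function using (_∘_; id)
open import Function.Bundles using (_⇔_; mk⇔)
open import Function.Definitions using (Injective)
open import Relation.Binary.PropositionalEquality
  using (_≡_; _≢_; refl; sym; trans; cong; cong₂; subst; module ≡-Reasoning)
open import Relation.Nullary using (¬_; Dec; yes; no; does; ¬?; contradiction)
open import Relation.Nullary.Decidable using (decidable-stable; map′)

open FiniteSum (CommutativeRing.+-commutativeMonoid xor-∧-commutativeRing)
  using (sum; sum-cong-≗; sum-remove)

open xor-∧-Solver using (solve; _:=_; _:+_; _:*_; con)

-- Acyclicity and rank functions

ArcMatrix : ℕ → Set
ArcMatrix n = Fin n → Fin n → Bool

-- A positive certificate of acyclicity. The bound `N` is left free and `r` need not be injective,
-- so that ranks can be refined lexicographically or placed one after another.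
Ordered : ∀ {n} → ArcMatrix n → Set
Ordered {n} e = ∃[ N ] Σ[ r ∈ (Fin n → Fin N) ] ∀ u v → T (e u v) → r u Fin.< r v

Ordered-cong : ∀ {n} {e e′ : ArcMatrix n} → (∀ u v → e u v ≡ e′ u v) → Ordered e → Ordered e′
Ordered-cong e≡e′ (N , r , mono) = N , r , λ u v → mono u v ∘ subst T (sym (e≡e′ u v))

ordered⇒acyclic : ∀ {n} (D : OrientedGraph n) → Ordered (arc D) → Acyclic D
ordered⇒acyclic D (N , r , mono) C =
  ℕₚ.<-irrefl refl (ℕₚ.<-≤-trans (mono _ _ close) (ascend ℓ vertex step))
  where
  open DirectedCycle C
  ascend : ∀ k (w : Fin (suc k) → Fin _) → (∀ i → Arc D (w (inject₁ i)) (w (suc i))) →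
           toℕ (r (w zero)) ℕ.≤ toℕ (r (w (fromℕ k)))
  ascend zero    w st = ℕₚ.≤-refl
  ascend (suc k) w st =
    ℕₚ.≤-trans (ℕₚ.<⇒≤ (mono _ _ (st zero))) (ascend k (w ∘ suc) (st ∘ suc))

record Path {n} (D : OrientedGraph n) (ℓ : ℕ) : Set where
  field
    vertex    : Fin (suc ℓ) → Fin n
    injective : Injective _≡_ _≡_ vertex
    step      : ∀ i → Arc D (vertex (inject₁ i)) (vertex (suc i))

closePath : ∀ {n} {D : OrientedGraph n} {ℓ} (P : Path D ℓ) j →
            Arc D (Path.vertex P j) (Path.vertex P zero) → DirectedCycle D
closePath {D = D} {ℓ} P j arcⱼ₀ = record
  { ℓ         = toℕ j
  ; vertex    = vertex ∘ prefix
  ; injective = Finₚ.inject≤-injective _ _ _ _ ∘ injective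
  ; step      = λ i → subst (λ w → Arc D (vertex w) (vertex (suc (inject≤ i (Finₚ.toℕ≤pred[n] j)))))
                        (prefix-inject₁ i) (step (inject≤ i (Finₚ.toℕ≤pred[n] j)))
  ; close     = subst (λ w → Arc D (vertex w) (vertex zero)) (sym prefix-last) arcⱼ₀
  }
  where
  open Path P
  open ≡-Reasoning
  prefix : Fin (suc (toℕ j)) → Fin (suc ℓ)
  prefix i = inject≤ i (Finₚ.toℕ<n j)

  prefix-inject₁ : ∀ i → inject₁ (inject≤ i (Finₚ.toℕ≤pred[n] j)) ≡ prefix (inject₁ i)
  prefix-inject₁ i = Finₚ.toℕ-injective (begin
    toℕ (inject₁ (inject≤ i (Finₚ.toℕ≤pred[n] j))) ≡⟨ Finₚ.toℕ-inject₁ _ ⟩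
    toℕ (inject≤ i (Finₚ.toℕ≤pred[n] j))           ≡⟨ Finₚ.toℕ-inject≤ i _ ⟩
    toℕ i                                          ≡⟨ Finₚ.toℕ-inject₁ i ⟨
    toℕ (inject₁ i)                                ≡⟨ Finₚ.toℕ-inject≤ (inject₁ i) _ ⟨
    toℕ (prefix (inject₁ i))                       ∎)

  prefix-last : prefix (fromℕ (toℕ j)) ≡ j
  prefix-last = Finₚ.toℕ-injective (trans (Finₚ.toℕ-inject≤ (fromℕ (toℕ j)) _) (Finₚ.toℕ-fromℕ (toℕ j)))

-- Extend a path backwards through predecessors. As its vertices are distinct, this cannot go on
-- forever, so some predecessor already lies on the path and closes a cycle.
noSource⇒cycle : ∀ {n} (D : OrientedGraph n) → (∀ v → ∃[ u ] Arc D u v) → Fin n → DirectedCycle D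
noSource⇒cycle {n} D pred v₀ =
  grow n 0 (ℕₚ.m≤m+n n 0)
    record { vertex = λ _ → v₀ ; injective = λ { {zero} {zero} _ → refl } ; step = λ () }
  where
  -- The invariant makes the path too long once the fuel is spent: it then has `suc ℓ` distinct
  -- vertices although `n` is at most `ℓ`.
  grow : ∀ fuel ℓ → n ℕ.≤ fuel + ℓ → Path D ℓ → DirectedCycle D
  grow zero       ℓ n≤ℓ P = contradiction (ℕₚ.≤-trans (Finₚ.injective⇒≤ (Path.injective P)) n≤ℓ) ℕₚ.1+n≰n
  grow (suc fuel) ℓ n≤  P with pred (Path.vertex P zero)
  ... | u , u→ with any? (λ j → Path.vertex P j Finₚ.≟ u)
  ...   | yes (j , refl) = closePath P j u→
  ...   | no  fresh      = grow fuel (suc ℓ) (subst (n ℕ.≤_) (sym (ℕₚ.+-suc fuel ℓ)) n≤) record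
    { vertex    = u VF.∷ vertex
    ; injective = λ { {zero}  {zero}  _  → refl
                    ; {zero}  {suc j} eq → contradiction (j , sym eq) fresh
                    ; {suc i} {zero}  eq → contradiction (i , eq) fresh
                    ; {suc i} {suc j} eq → cong suc (injective eq) }
    ; step      = λ { zero → u→ ; (suc i) → step i }
    }
    where open Path P

delete : ∀ {n} → OrientedGraph (suc n) → Fin (suc n) → OrientedGraph n
delete D s = record { arc = λ u v → arc D (punchIn s u) (punchIn s v) ; asym = asym D }

-- Without a source there is a cycle. Otherwise a source gets rank 0, and the ranks of the remaining
-- vertices, obtained by induction, move up by one.
cycle⊎ordered : ∀ {n} (D : OrientedGraph n) → DirectedCycle D ⊎ Ordered (arc D)
cycle⊎ordered {zero}  D = inj₂ (0 , (λ ()) , λ ())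
cycle⊎ordered {suc n} D with Finₚ.all? (λ v → any? (λ u → T? (arc D u v)))
... | yes pred = inj₁ (noSource⇒cycle D pred zero)
... | no ¬pred with Finₚ.¬∀⟶∃¬ _ _ (λ v → any? (λ u → T? (arc D u v))) ¬pred
...   | s , source with cycle⊎ordered (delete D s)
...     | inj₁ C = inj₁ record
  { ℓ = ℓ ; vertex = punchIn s ∘ vertex ; injective = injective ∘ Finₚ.punchIn-injective s _ _
  ; step = step ; close = close }
  where open DirectedCycle C
...     | inj₂ (N , r , mono) = inj₂ (suc N , rank , rank-mono)
  where
  rank : Fin (suc n) → Fin (suc N)
  rank v with s Finₚ.≟ v
  ... | yes _   = zero
  ... | no  s≢v = suc (r (punchOut s≢v))

  rank-mono : ∀ u v → Arc D u v → rank u Fin.< rank v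
  rank-mono u v u→v with s Finₚ.≟ u | s Finₚ.≟ v
  ... | _       | yes refl = contradiction (u , u→v) source
  ... | yes _   | no _     = s≤s z≤n
  ... | no  s≢u | no s≢v   = s≤s (mono _ _ (subst T (sym (cong₂ (arc D)
          (Finₚ.punchIn-punchOut s≢u) (Finₚ.punchIn-punchOut s≢v))) u→v))

acyclic⇒ordered : ∀ {n} (D : OrientedGraph n) → Acyclic D → Ordered (arc D)
acyclic⇒ordered D acyclic with cycle⊎ordered D
... | inj₁ C   = contradiction C acyclic
... | inj₂ ord = ord

acyclic? : ∀ {n} (D : OrientedGraph n) → Dec (Acyclic D)
acyclic? D with cycle⊎ordered D
... | inj₁ C   = no λ acyclic → acyclic C
... | inj₂ ord = yes (ordered⇒acyclic D ord)

-- Exhaustive search; it makes the choice between the two values of the inversion number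
-- constructive.
decyclable? : ∀ {n} (D : OrientedGraph n) m → Dec (∃[ Xs ] Decycling {m = m} D Xs)
decyclable? D zero    = map′ ([] ,_) (λ { ([] , acyclic) → acyclic }) (acyclic? D)
decyclable? D (suc m) =
  map′ (λ { (X , Xs , acyclic) → X ∷ Xs , acyclic }) (λ { (X ∷ Xs , acyclic) → X , Xs , acyclic })
    (anySubset? λ X → decyclable? (invert D X) m)

-- The dot product over 𝔽₂

𝔽₂^_ : ℕ → Set
𝔽₂^ m = Vector Bool m

𝟎 𝟏 : ∀ {m} → 𝔽₂^ m
𝟎 _ = false
𝟏 _ = true

infixl 6 _+[_]_

_+[_]_ : ∀ {m} → 𝔽₂^ m → Bool → 𝔽₂^ m → 𝔽₂^ m
(x +[ s ] a) i = x i xor (s ∧ a i)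

opaque
  dot : ∀ {m} → 𝔽₂^ m → 𝔽₂^ m → Bool
  dot x y = sum λ i → x i ∧ y i

  dot-cong : ∀ {m} {x x′ y y′ : 𝔽₂^ m} → (∀ i → x i ≡ x′ i) → (∀ i → y i ≡ y′ i) → dot x y ≡ dot x′ y′
  dot-cong x≡x′ y≡y′ = sum-cong-≗ λ i → cong₂ _∧_ (x≡x′ i) (y≡y′ i)

  dot-congˡ : ∀ {m} {x x′ : 𝔽₂^ m} → (∀ i → x i ≡ x′ i) → ∀ y → dot x y ≡ dot x′ y
  dot-congˡ x≡x′ y = sum-cong-≗ λ i → cong (_∧ y i) (x≡x′ i)

  dot-comm : ∀ {m} (x y : 𝔽₂^ m) → dot x y ≡ dot y x
  dot-comm x y = sum-cong-≗ λ i → ∧-comm (x i) (y i)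

  dot-+ˡ : ∀ {m} (x : 𝔽₂^ m) s a z → dot (x +[ s ] a) z ≡ dot x z xor (s ∧ dot a z)
  dot-+ˡ {zero}  x false a z = refl
  dot-+ˡ {zero}  x true  a z = refl
  dot-+ˡ {suc m} x s a z =
    trans (cong (((x zero xor (s ∧ a zero)) ∧ z zero) xor_) (dot-+ˡ (x ∘ suc) s (a ∘ suc) (z ∘ suc)))
      (solve 6 (λ x₀ s a₀ z₀ xz az →
        ((x₀ :+ s :* a₀) :* z₀ :+ (xz :+ s :* az)) := (x₀ :* z₀ :+ xz) :+ s :* (a₀ :* z₀ :+ az))
        refl (x zero) s (a zero) (z zero) (dot (x ∘ suc) (z ∘ suc)) (dot (a ∘ suc) (z ∘ suc)))

  dot-𝟎ˡ : ∀ {m} (x : 𝔽₂^ m) → dot 𝟎 x ≡ false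
  dot-𝟎ˡ {zero}  x = refl
  dot-𝟎ˡ {suc m} x = dot-𝟎ˡ (x ∘ suc)

  -- Squaring is the identity on 𝔽₂, so the norm x · x is a linear functional, represented by `𝟏`.
  dot-𝟏 : ∀ {m} (x : 𝔽₂^ m) → dot 𝟏 x ≡ dot x x
  dot-𝟏 x = sum-cong-≗ λ i → sym (∧-idem (x i))

  dot-𝟏𝟏⇒odd : ∀ m → dot (𝟏 {m}) 𝟏 ≡ true → m % 2 ≡ 1
  dot-𝟏𝟏⇒odd 1             _  = refl
  dot-𝟏𝟏⇒odd (suc (suc m)) eq = dot-𝟏𝟏⇒odd m
    (trans (solve 1 (λ x → x := con true :+ (con true :+ x)) refl (dot (𝟏 {m}) 𝟏)) eq)

  dot-∷ : ∀ {m} (x y : 𝔽₂^ (suc m)) → dot x y ≡ (x zero ∧ y zero) xor dot (x ∘ suc) (y ∘ suc)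
  dot-∷ x y = refl

  dot-[] : ∀ (x y : 𝔽₂^ 0) → dot x y ≡ false
  dot-[] x y = refl

  dot-removeAt : ∀ {m} (x y : 𝔽₂^ (suc m)) i → dot x y ≡ (x i ∧ y i) xor dot (removeAt x i) (removeAt y i)
  dot-removeAt x y i = sum-remove {i = i} λ j → x j ∧ y j

dot-+ʳ : ∀ {m} (z : 𝔽₂^ m) x s a → dot z (x +[ s ] a) ≡ dot z x xor (s ∧ dot z a)
dot-+ʳ z x s a = trans (dot-comm z _) (trans (dot-+ˡ x s a z)
  (cong₂ (λ p q → p xor (s ∧ q)) (dot-comm x z) (dot-comm a z)))

dot-+-+ : ∀ {m} (x : 𝔽₂^ m) s a y t b →
          dot (x +[ s ] a) (y +[ t ] b) ≡
          (dot x y xor (t ∧ dot x b)) xor (s ∧ (dot a y xor (t ∧ dot a b)))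
dot-+-+ x s a y t b = trans (dot-+ˡ x s a _)
  (cong₂ (λ p q → p xor (s ∧ q)) (dot-+ʳ x y t b) (dot-+ʳ a y t b))

-- For a with a·a = 1 and a i = 0, the transvection along a + eᵢ sends a to eᵢ;
-- on the complement of a it is y ↦ y + yᵢ(a + eᵢ), and forgetting the
-- coordinate i identifies the image with 𝔽₂^ m.
contract : ∀ {m} → 𝔽₂^ (suc m) → Fin (suc m) → 𝔽₂^ (suc m) → 𝔽₂^ m
contract a i y = removeAt (y +[ y i ] a) i

-- On the complement of `a` the cross terms vanish, so adding the multiples of `a` changes the
-- product by yᵢzᵢ(a · a) = yᵢzᵢ. As aᵢ = 0, this is exactly the coordinate term that the deletion
-- takes away.
contract-isometry : ∀ {m} (a : 𝔽₂^ (suc m)) i → dot a a ≡ true → a i ≡ false →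
                    ∀ y z → dot a y ≡ false → dot a z ≡ false →
                    dot (contract a i y) (contract a i z) ≡ dot y z
contract-isometry a i aa aᵢ y z ay az = begin
  dot (contract a i y) (contract a i z)
    ≡⟨ solve 2 (λ p q → q := p :+ (p :+ q)) refl p _ ⟩
  p xor (p xor dot (contract a i y) (contract a i z))
    ≡⟨ cong (p xor_) (dot-removeAt y′ z′ i) ⟨
  p xor dot y′ z′
    ≡⟨ cong (p xor_) (dot-+-+ y (y i) a z (z i) a) ⟩
  p xor ((dot y z xor (z i ∧ dot y a)) xor (y i ∧ (dot a z xor (z i ∧ dot a a))))
    ≡⟨ expand ⟩
  dot y z ∎
  where
  open ≡-Reasoning
  y′ = y +[ y i ] a
  z′ = z +[ z i ] a
  p  = y′ i ∧ z′ i
  expand : p xor ((dot y z xor (z i ∧ dot y a)) xor (y i ∧ (dot a z xor (z i ∧ dot a a)))) ≡ dot y z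
  expand rewrite dot-comm y a | ay | az | aa | aᵢ =
    solve 3 (λ yᵢ zᵢ yz → ((yᵢ :+ yᵢ :* con false) :* (zᵢ :+ zᵢ :* con false)) :+
                          ((yz :+ zᵢ :* con false) :+ yᵢ :* (con false :+ zᵢ :* con true)) := yz)
      refl (y i) (z i) (dot y z)

-- Complements of one or two vectors of norm 1

zeroCoordinate : ∀ {m} (a : 𝔽₂^ m) → (∃[ i ] a i ≡ false) ⊎ (∀ i → a i ≡ true)
zeroCoordinate a with any? (λ i → a i ≟ false)
... | yes i  = inj₁ i
... | no all = inj₂ λ i → ¬-not λ aᵢ → all (i , aᵢ)

-- The orthogonal complement of 𝟏 in odd dimension carries an alternating form,
-- and is the only kind of complement of a vector of norm 1 not isometric to a
-- standard space.
record Even {n} (m : ℕ) (G : ArcMatrix n) : Set where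
  field
    odd   : dot (𝟏 {m}) 𝟏 ≡ true
    y     : Fin n → 𝔽₂^ m
    y⊥𝟏   : ∀ v → dot 𝟏 (y v) ≡ false
    gram≡ : ∀ u v → dot (y u) (y v) ≡ G u v

Gram : ∀ {n} (m : ℕ) (G : ArcMatrix n) → Set
Gram {n} m G = Σ[ y ∈ (Fin n → 𝔽₂^ m) ] ∀ u v → dot (y u) (y v) ≡ G u v

complement₁ : ∀ {n m} (y : Fin n → 𝔽₂^ (suc m)) (a : 𝔽₂^ (suc m)) →
              dot a a ≡ true → (∀ v → dot a (y v) ≡ false) →
              Gram m (λ u v → dot (y u) (y v)) ⊎ Even (suc m) (λ u v → dot (y u) (y v))
complement₁ y a aa a⊥y with zeroCoordinate a
... | inj₁ (i , aᵢ) = inj₁ (contract a i ∘ y ,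
        λ u v → contract-isometry a i aa aᵢ (y u) (y v) (a⊥y u) (a⊥y v))
... | inj₂ a≡𝟏 = inj₂ record
  { odd = trans (dot-cong (sym ∘ a≡𝟏) (sym ∘ a≡𝟏)) aa ; y = y
  ; y⊥𝟏 = λ v → trans (sym (dot-congˡ a≡𝟏 (y v))) (a⊥y v) ; gram≡ = λ _ _ → refl }

-- The `even` case loses only one dimension: the first vector has been contracted, and the image of
-- the second is `𝟏`, which has no zero coordinate to contract along.
data Complement {n} (G : ArcMatrix n) : ℕ → Set where
  standard : ∀ {m} → Gram m G → Complement G (2 + m)
  even     : ∀ {m} → Even m G → Complement G (1 + m)

-- Contract along `a` first. This is possible because `a` = `𝟏` would give a · b = b · b = 1. The
-- image of `b` still has norm 1 and is still orthogonal to the family, so `complement₁` applies to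
-- it.
complement₂ : ∀ {n m} (y : Fin n → 𝔽₂^ m) (a b : 𝔽₂^ m) →
              dot a a ≡ true → dot b b ≡ true → dot a b ≡ false →
              (∀ v → dot a (y v) ≡ false) → (∀ v → dot b (y v) ≡ false) →
              Complement (λ u v → dot (y u) (y v)) m
complement₂ {m = zero} y a b aa bb ab a⊥y b⊥y = contradiction (trans (sym aa) (dot-[] a a)) λ ()
complement₂ {m = suc m} y a b aa bb ab a⊥y b⊥y with zeroCoordinate a
... | inj₂ a≡𝟏 =
  contradiction (trans (sym bb) (trans (sym (dot-𝟏 b)) (trans (sym (dot-congˡ a≡𝟏 b)) ab))) λ ()
... | inj₁ (i , aᵢ) = descend m y′ b′ b′b′ b′⊥y′ gram
  where
  y′ = contract a i ∘ y
  b′ = contract a i b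
  iso = contract-isometry a i aa aᵢ
  b′b′ : dot b′ b′ ≡ true
  b′b′ = trans (iso b b ab ab) bb
  b′⊥y′ : ∀ v → dot b′ (y′ v) ≡ false
  b′⊥y′ v = trans (iso b (y v) ab (a⊥y v)) (b⊥y v)
  gram : ∀ u v → dot (y′ u) (y′ v) ≡ dot (y u) (y v)
  gram u v = iso (y u) (y v) (a⊥y u) (a⊥y v)

  descend : ∀ m (y′ : Fin _ → 𝔽₂^ m) b′ → dot b′ b′ ≡ true → (∀ v → dot b′ (y′ v) ≡ false) →
            (∀ u v → dot (y′ u) (y′ v) ≡ dot (y u) (y v)) →
            Complement (λ u v → dot (y u) (y v)) (suc m)
  descend zero    y′ b′ b′b′ _     _ = contradiction (trans (sym b′b′) (dot-[] b′ b′)) λ ()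
  descend (suc m) y′ b′ b′b′ b′⊥y′ gram with complement₁ y′ b′ b′b′ b′⊥y′
  ... | inj₁ (z , z≡) = standard (z , λ u v → trans (z≡ u v) (gram u v))
  ... | inj₂ E        = even record { Even E ; gram≡ = λ u v → trans (Even.gram≡ E u v) (gram u v) }

-- Every symmetric bilinear form on the span of two functionals α, β is of this shape.
form : (p q t : Bool) {n : ℕ} (α β : Fin n → Bool) → ArcMatrix n
form p q t α β u v =
  (p ∧ (α u ∧ α v)) xor ((q ∧ (β u ∧ β v)) xor (t ∧ ((α u xor β u) ∧ (α v xor β v))))

form-swap : ∀ {n} p q t (α β : Fin n → Bool) u v → form q p t β α u v ≡ form p q t α β u v
form-swap p q t α β u v = solve 7 (λ p q t αᵤ αᵥ βᵤ βᵥ →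
    q :* (βᵤ :* βᵥ) :+ (p :* (αᵤ :* αᵥ) :+ t :* ((βᵤ :+ αᵤ) :* (βᵥ :+ αᵥ))) :=
    p :* (αᵤ :* αᵥ) :+ (q :* (βᵤ :* βᵥ) :+ t :* ((αᵤ :+ βᵤ) :* (αᵥ :+ βᵥ))))
  refl p q t (α u) (α v) (β u) (β v)

complement-cong : ∀ {n m} {G H : ArcMatrix n} → (∀ u v → G u v ≡ H u v) → Complement G m → Complement H m
complement-cong G≡H (standard (y , y≡)) = standard (y , λ u v → trans (y≡ u v) (G≡H u v))
complement-cong G≡H (even E) = even record { Even E ; gram≡ = λ u v → trans (Even.gram≡ E u v) (G≡H u v) }

-- Projection to the complement of a plane or a vector

𝐞 : ∀ {m} → 𝔽₂^ (suc m)
𝐞 = true VF.∷ 𝟎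

dot-𝐞 : ∀ {m} (x : 𝔽₂^ (suc m)) → dot 𝐞 x ≡ x zero
dot-𝐞 x rewrite dot-∷ 𝐞 x | dot-𝟎ˡ (x ∘ suc) = xor-identityʳ (x zero)

-- The witness is the projection of 𝐞 to the complement of a and b; the component of 𝐞
-- in their span has norm 2 a₀ b₀ = 0.
hyperbolic-complement : ∀ {m} (a b : 𝔽₂^ m) → dot a a ≡ false → dot b b ≡ false → dot a b ≡ true →
                        Σ[ c ∈ 𝔽₂^ m ] dot a c ≡ false × dot b c ≡ false × dot c c ≡ true
hyperbolic-complement {zero}  a b aa bb ab = contradiction (trans (sym ab) (dot-[] a b)) λ ()
hyperbolic-complement {suc m} a b aa bb ab = c , ac , bc , cc
  where
  c : 𝔽₂^ (suc m)
  c = 𝐞 +[ b zero ] a +[ a zero ] b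
  dot-c : ∀ x → dot x c ≡ (x zero xor (b zero ∧ dot x a)) xor (a zero ∧ dot x b)
  dot-c x rewrite dot-+ʳ x (𝐞 +[ b zero ] a) (a zero) b | dot-+ʳ x 𝐞 (b zero) a
                | dot-comm x 𝐞 | dot-𝐞 x = refl
  ac : dot a c ≡ false
  ac rewrite dot-c a | aa | ab =
    solve 2 (λ a₀ b₀ → (a₀ :+ b₀ :* con false) :+ a₀ :* con true := con false) refl (a zero) (b zero)
  bc : dot b c ≡ false
  bc rewrite dot-c b | bb | dot-comm b a | ab =
    solve 2 (λ a₀ b₀ → (b₀ :+ b₀ :* con true) :+ a₀ :* con false := con false) refl (a zero) (b zero)
  cc : dot c c ≡ true
  cc rewrite dot-c c | dot-comm c a | dot-comm c b | ac | bc =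
    solve 2 (λ a₀ b₀ → (((con true :+ b₀ :* a₀) :+ a₀ :* b₀) :+ b₀ :* con false) :+ a₀ :* con false := con true)
      refl (a zero) (b zero)

module Project {n m} (y : Fin n → 𝔽₂^ m) (a b : 𝔽₂^ m) where
  α β : Fin n → Bool
  α v = dot a (y v)
  β v = dot b (y v)

  -- Removing the components along `a` and `b` changes the Gram matrix by αᵤαᵥ + βᵤβᵥ.
  orthonormal : dot a a ≡ true → dot b b ≡ true → dot a b ≡ false →
                Complement (λ u v → dot (y u) (y v) xor form true true false α β u v) m
  orthonormal aa bb ab = complement-cong gram (complement₂ y′ a b aa bb ab a⊥ b⊥)
    where
    y′ : Fin n → 𝔽₂^ m
    y′ v = y v +[ α v ] a +[ β v ] b
    a⊥ : ∀ v → dot a (y′ v) ≡ false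
    a⊥ v rewrite dot-+ʳ a (y v +[ α v ] a) (β v) b | dot-+ʳ a (y v) (α v) a | aa | ab =
      solve 2 (λ α β → (α :+ α :* con true) :+ β :* con false := con false) refl (α v) (β v)
    b⊥ : ∀ v → dot b (y′ v) ≡ false
    b⊥ v rewrite dot-+ʳ b (y v +[ α v ] a) (β v) b | dot-+ʳ b (y v) (α v) a | bb | dot-comm b a | ab =
      solve 2 (λ α β → (β :+ α :* con false) :+ β :* con true := con false) refl (α v) (β v)
    gram : ∀ u v → dot (y′ u) (y′ v) ≡ dot (y u) (y v) xor form true true false α β u v
    gram u v
      rewrite dot-+ˡ (y u +[ α u ] a) (β u) b (y′ v) | b⊥ v
            | dot-+ˡ (y u) (α u) a (y′ v) | a⊥ v
            | dot-+ʳ (y u) (y v +[ α v ] a) (β v) b | dot-+ʳ (y u) (y v) (α v) a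
            | dot-comm (y u) a | dot-comm (y u) b
      = solve 5 (λ g αᵤ αᵥ βᵤ βᵥ →
          ((((g :+ αᵥ :* αᵤ) :+ βᵥ :* βᵤ) :+ αᵤ :* con false) :+ βᵤ :* con false)
          := g :+ (αᵤ :* αᵥ :+ (βᵤ :* βᵥ :+ con false)))
          refl (dot (y u) (y v)) (α u) (α v) (β u) (β v)

  -- A vector orthogonal to a and b is γ c plus a vector orthogonal to a, b and c.
  -- As a + c, b + c, a + b + c are orthonormal, replacing c by a + b + c
  -- is an isometry into the complement of a + c and b + c.
  hyperbolic : dot a a ≡ false → dot b b ≡ false → dot a b ≡ true →
               ∀ c → dot a c ≡ false → dot b c ≡ false → dot c c ≡ true →
               Complement (λ u v → dot (y u) (y v) xor form true true true α β u v) m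
  hyperbolic aa bb ab c ac bc cc = complement-cong gram (complement₂ y′ (a +[ true ] c) (b +[ true ] c)
      (norm-1 a aa ac) (norm-1 b bb bc) a+c⊥b+c (+c⊥ a ay′) (+c⊥ b by′))
    where
    γ : Fin n → Bool
    γ v = dot c (y v)
    y′ : Fin n → 𝔽₂^ m
    -- In a hyperbolic plane the dual basis of a, b is b, a, hence the crossed coefficients that
    -- remove the component in the plane. The further `γ` (a + b) turns `γ` c into `γ` (a + b + c).
    y′ v = y v +[ β v xor γ v ] a +[ α v xor γ v ] b
    y′-expand : ∀ z v → dot z (y′ v) ≡
                (dot z (y v) xor ((β v xor γ v) ∧ dot z a)) xor ((α v xor γ v) ∧ dot z b)
    y′-expand z v = trans (dot-+ʳ z (y v +[ β v xor γ v ] a) (α v xor γ v) b)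
      (cong (_xor ((α v xor γ v) ∧ dot z b)) (dot-+ʳ z (y v) (β v xor γ v) a))
    ay′ : ∀ v → dot a (y′ v) ≡ γ v
    ay′ v rewrite y′-expand a v | aa | ab =
      solve 3 (λ α β γ → (α :+ (β :+ γ) :* con false) :+ (α :+ γ) :* con true := γ) refl (α v) (β v) (γ v)
    by′ : ∀ v → dot b (y′ v) ≡ γ v
    by′ v rewrite y′-expand b v | bb | dot-comm b a | ab =
      solve 3 (λ α β γ → (β :+ (β :+ γ) :* con true) :+ (α :+ γ) :* con false := γ) refl (α v) (β v) (γ v)
    cy′ : ∀ v → dot c (y′ v) ≡ γ v
    cy′ v rewrite y′-expand c v | dot-comm c a | dot-comm c b | ac | bc =
      solve 3 (λ α β γ → (γ :+ (β :+ γ) :* con false) :+ (α :+ γ) :* con false := γ) refl (α v) (β v) (γ v)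
    +c⊥ : ∀ x → (∀ v → dot x (y′ v) ≡ γ v) → ∀ v → dot (x +[ true ] c) (y′ v) ≡ false
    +c⊥ x xy′ v rewrite dot-+ˡ x true c (y′ v) | xy′ v | cy′ v = xor-same (γ v)
    norm-1 : ∀ x → dot x x ≡ false → dot x c ≡ false → dot (x +[ true ] c) (x +[ true ] c) ≡ true
    norm-1 x xx xc rewrite dot-+-+ x true c x true c | xx | xc | dot-comm c x | xc | cc = refl
    a+c⊥b+c : dot (a +[ true ] c) (b +[ true ] c) ≡ false
    a+c⊥b+c rewrite dot-+-+ a true c b true c | ab | ac | dot-comm c b | bc | cc = refl
    -- With all three coefficients 1, `form` is the alternating form αᵤβᵥ + βᵤαᵥ.
    gram : ∀ u v → dot (y′ u) (y′ v) ≡ dot (y u) (y v) xor form true true true α β u v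
    gram u v
      rewrite dot-+ˡ (y u +[ β u xor γ u ] a) (α u xor γ u) b (y′ v) | by′ v
            | dot-+ˡ (y u) (β u xor γ u) a (y′ v) | ay′ v
            | y′-expand (y u) v | dot-comm (y u) a | dot-comm (y u) b
      = solve 7 (λ g αᵤ αᵥ βᵤ βᵥ γᵤ γᵥ →
          ((((g :+ (βᵥ :+ γᵥ) :* αᵤ) :+ (αᵥ :+ γᵥ) :* βᵤ) :+ (βᵤ :+ γᵤ) :* γᵥ) :+ (αᵤ :+ γᵤ) :* γᵥ)
          := g :+ (αᵤ :* αᵥ :+ (βᵤ :* βᵥ :+ (αᵤ :+ βᵤ) :* (αᵥ :+ βᵥ))))
          refl (dot (y u) (y v)) (α u) (α v) (β u) (β v) (γ u) (γ v)

-- The hypothesis says that `a` and `b` have Gram determinant 1, which leaves four Gram matrices. If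
-- one of the vectors has norm 1, the plane has an orthonormal basis, with a + b replacing a vector
-- of norm 0; otherwise the plane is hyperbolic.
project : ∀ {n m} (y : Fin n → 𝔽₂^ m) (a b : 𝔽₂^ m) → dot a b ≢ dot a a ∧ dot b b →
          ∃[ p ] ∃[ q ] ∃[ t ]
            Complement (λ u v → dot (y u) (y v) xor form p q t (dot a ∘ y) (dot b ∘ y) u v) m
project y a b det with dot a a in aa | dot b b in bb | dot a b in ab
... | true  | true  | true  = contradiction refl det
... | true  | false | false = contradiction refl det
... | false | _     | false = contradiction refl det
... | true  | true  | false = true , true , false , orthonormal aa bb ab
  where open Project y a b
... | true  | false | true  = true , false , true ,
  complement-cong (λ u v → cong (dot (y u) (y v) xor_) (form≡ u v)) (orthonormal aa a+b a⊥)
  where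
  open Project y a (a +[ true ] b)
  a+b : dot (a +[ true ] b) (a +[ true ] b) ≡ true
  a+b rewrite dot-+-+ a true b a true b | aa | ab | dot-comm b a | ab | bb = refl
  a⊥ : dot a (a +[ true ] b) ≡ false
  a⊥ rewrite dot-+ʳ a a true b | aa | ab = refl
  form≡ : ∀ u v → form true true false α β u v ≡ form true false true α (dot b ∘ y) u v
  form≡ u v rewrite dot-+ˡ a true b (y u) | dot-+ˡ a true b (y v) =
    cong ((α u ∧ α v) xor_) (xor-identityʳ _)
... | false | true  | true  = false , true , true ,
  complement-cong (λ u v → cong (dot (y u) (y v) xor_) (form≡ u v)) (orthonormal a+b bb ⊥b)
  where
  open Project y (a +[ true ] b) b
  a+b : dot (a +[ true ] b) (a +[ true ] b) ≡ true
  a+b rewrite dot-+-+ a true b a true b | aa | ab | dot-comm b a | ab | bb = refl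
  ⊥b : dot (a +[ true ] b) b ≡ false
  ⊥b rewrite dot-+ˡ a true b b | ab | bb = refl
  form≡ : ∀ u v → form true true false α β u v ≡ form false true true (dot a ∘ y) β u v
  form≡ u v rewrite dot-+ˡ a true b (y u) | dot-+ˡ a true b (y v) =
    solve 2 (λ s t → s :+ (t :+ con false) := t :+ s) refl
      ((dot a (y u) xor β u) ∧ (dot a (y v) xor β v)) (β u ∧ β v)
... | false | false | true  = let c , ac , bc , cc = hyperbolic-complement a b aa bb ab in
  true , true , true , Project.hyperbolic y a b aa bb ab c ac bc cc

project₁ : ∀ {n m} (y : Fin n → 𝔽₂^ (suc m)) (a : 𝔽₂^ (suc m)) → dot a a ≡ true →
           let G = λ u v → dot (y u) (y v) xor form true false false (dot a ∘ y) (dot a ∘ y) u v in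
           Gram m G ⊎ Even (suc m) G
project₁ {n} {m} y a aa = Sum.map
  (λ (z , z≡) → z , λ u v → trans (z≡ u v) (gram u v))
  (λ E → record { Even E ; gram≡ = λ u v → trans (Even.gram≡ E u v) (gram u v) })
  (complement₁ y′ a aa a⊥)
  where
  y′ : Fin n → 𝔽₂^ (suc m)
  y′ v = y v +[ dot a (y v) ] a
  a⊥ : ∀ v → dot a (y′ v) ≡ false
  a⊥ v rewrite dot-+ʳ a (y v) (dot a (y v)) a | aa =
    solve 1 (λ α → α :+ α :* con true := con false) refl (dot a (y v))
  gram : ∀ u v → dot (y′ u) (y′ v) ≡
         dot (y u) (y v) xor form true false false (dot a ∘ y) (dot a ∘ y) u v
  gram u v rewrite dot-+ˡ (y u) (dot a (y u)) a (y′ v) | a⊥ v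
                 | dot-+ʳ (y u) (y v) (dot a (y v)) a | dot-comm (y u) a =
    solve 3 (λ g αᵤ αᵥ → (g :+ αᵥ :* αᵤ) :+ αᵤ :* con false := g :+ (αᵤ :* αᵥ :+ con false))
      refl (dot (y u) (y v)) (dot a (y u)) (dot a (y v))

-- Reversing blocks of an ordered graph

twist : ∀ {n} → ArcMatrix n → ArcMatrix n → ArcMatrix n
twist e G u v = if G u v then e v u else e u v

twist-cong : ∀ {n} (e : ArcMatrix n) {G H : ArcMatrix n} → (∀ u v → G u v ≡ H u v) →
             ∀ u v → twist e G u v ≡ twist e H u v
twist-cong e G≡H u v = cong (if_then e v u else e u v) (G≡H u v)

twist-twist : ∀ {n} (e G H : ArcMatrix n) → (∀ u v → G u v ≡ G v u) →
              ∀ u v → twist (twist e G) H u v ≡ twist e (λ u v → G u v xor H u v) u v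
twist-twist e G H G-sym u v rewrite G-sym v u with G u v | H u v
... | true  | true  = refl
... | true  | false = refl
... | false | true  = refl
... | false | false = refl

opposite-< : ∀ {N} (i j : Fin N) → i Fin.< j → opposite j Fin.< opposite i
opposite-< {N} i j i<j rewrite Finₚ.opposite-prop i | Finₚ.opposite-prop j =
  ℕₚ.∸-monoʳ-< (s≤s i<j) (Finₚ.toℕ<n j)

Monotone : ∀ {n N} → ArcMatrix n → (Fin n → Fin N) → Set
Monotone e c = ∀ u v → T (e u v) → c u Fin.≤ c v

isBlock : ∀ {n N} → (Fin n → Fin N) → Fin N → Fin n → Bool
isBlock c j v = does (c v Finₚ.≟ j)

block : ∀ {n N} → Bool → (Fin n → Fin N) → Fin N → ArcMatrix n
block s c j u v = s ∧ (isBlock c j u ∧ isBlock c j v)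

-- The fibres of the monotone map `c` are consecutive blocks. Ranking first by `c` and then by the
-- old rank, turned around inside block `j`, fits the reversed arcs. Only arcs inside a fibre
-- change, so `c` stays monotone and further blocks can be reversed.
twist-block : ∀ {n N} {e : ArcMatrix n} {c : Fin n → Fin N} s j → Monotone e c → Ordered e →
              Monotone (twist e (block s c j)) c × Ordered (twist e (block s c j))
twist-block false j mono ord = mono , ord
twist-block {n} {N} {e} {c} true j mono (M , r , r-mono) = mono′ , N ℕ.* M , r′ , r′-mono
  where
  mono′ : Monotone (twist e (block true c j)) c
  mono′ u v t with c u Finₚ.≟ j | c v Finₚ.≟ j
  ... | yes refl | yes cv = ℕₚ.≤-reflexive (cong toℕ (sym cv))
  ... | yes _    | no  _  = mono u v t
  ... | no  _    | _      = mono u v t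

  within : Fin n → Fin M
  within v = if isBlock c j v then opposite (r v) else r v

  r′ : Fin n → Fin (N ℕ.* M)
  r′ v = combine (c v) (within v)

  same : ∀ u v → c u ≡ c v → T (twist e (block true c j) u v) → within u Fin.< within v
  same u v cu≡cv t with c u Finₚ.≟ j | c v Finₚ.≟ j
  ... | yes _  | yes _  = opposite-< (r v) (r u) (r-mono v u t)
  ... | yes cu | no cv  = contradiction (trans (sym cu≡cv) cu) cv
  ... | no cu  | yes cv = contradiction (trans cu≡cv cv) cu
  ... | no _   | no _   = r-mono u v t

  r′-mono : ∀ u v → T (twist e (block true c j) u v) → r′ u Fin.< r′ v
  r′-mono u v t with ℕₚ.m≤n⇒m<n∨m≡n (mono′ u v t)
  ... | inj₁ cu<cv = Finₚ.combine-monoˡ-< (within u) (within v) cu<cv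
  ... | inj₂ cu≡cv
    rewrite Finₚ.toℕ-combine (c u) (within u) | Finₚ.toℕ-combine (c v) (within v) | cu≡cv =
    ℕₚ.+-monoʳ-< (M ℕ.* toℕ (c v)) (same u v (Finₚ.toℕ-injective cu≡cv) t)

blockOf : Bool → Bool → Fin 3
blockOf true  _     = zero
blockOf false true  = suc zero
blockOf false false = suc (suc zero)

-- The sets α and β ∖ α are blocks of the order and may be reversed in place;
-- afterwards the initial segment β is still a block.
twist-form-nested : ∀ {n} {e : ArcMatrix n} (α β : Fin n → Bool) p q t →
                    (∀ u v → T (e u v) → T (α v) → T (α u)) →
                    (∀ u v → T (e u v) → T (β v) → T (β u)) →
                    (∀ v → T (α v) → T (β v)) →
                    Ordered e → Ordered (twist e (form p q t α β))
twist-form-nested {n} {e} α β p q t α↓ β↓ α⊆β ord =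
  Ordered-cong twists≡ (proj₂ (twist-block {c = c′} q zero mono′ (proj₂ step₂)))
  where
  c c′ : Fin n → Fin 3
  c  v = blockOf (α v) (β v)
  -- This merges the two lower layers: `β` is block 0, its complement is block 2, and block 1 is
  -- empty.
  c′ v = blockOf (β v) (β v)

  mono : Monotone e c
  mono u v u→v with α v | α↓ u v u→v | β v | β↓ u v u→v
  ... | false | _  | false | _  with α u | β u
  ...   | true  | _     = z≤n
  ...   | false | true  = s≤s z≤n
  ...   | false | false = s≤s (s≤s z≤n)
  mono u v u→v | true  | αu | _     | _  with α u | αu _
  ...   | true  | _     = z≤n
  mono u v u→v | false | _  | true  | βu with β u | βu _
  ...   | true  | _ with α u
  ...     | true  = z≤n
  ...     | false = s≤s z≤n

  step₁ = twist-block {c = c} p zero mono ord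
  step₂ = twist-block {c = c} t (suc zero) (proj₁ step₁) (proj₂ step₁)
  B₀ B₁ B₀′ e₂ : ArcMatrix n
  B₀  = block p c zero
  B₁  = block t c (suc zero)
  B₀′ = block q c′ zero
  e₂  = twist (twist e B₀) B₁

  coarsen : ∀ u v → c u Fin.≤ c v → c′ u Fin.≤ c′ v
  coarsen u v cu≤cv with α u | β u | α⊆β u | α v | β v | α⊆β v
  ... | _     | true  | _  | _     | _     | _  = z≤n
  ... | true  | false | αu | _     | _     | _  = ⊥-elim (αu _)
  ... | false | false | _  | _     | false | _  = s≤s (s≤s z≤n)
  coarsen u v () | false | false | _ | true  | true | _
  coarsen u v (s≤s ()) | false | false | _ | false | true | _

  mono′ : Monotone e₂ c′
  mono′ u v u→v = coarsen u v (proj₁ step₂ u v u→v)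

  in₀ : ∀ v → isBlock c zero v ≡ α v
  in₀ v with α v | β v
  ... | true  | _     = refl
  ... | false | true  = refl
  ... | false | false = refl
  -- As `α` lies inside `β`, their sum is the indicator of the middle layer; this is the third term
  -- of `form`.
  in₁ : ∀ v → isBlock c (suc zero) v ≡ α v xor β v
  in₁ v with α v | β v | α⊆β v
  ... | true  | true  | _  = refl
  ... | true  | false | αv = ⊥-elim (αv _)
  ... | false | true  | _  = refl
  ... | false | false | _  = refl
  in₀′ : ∀ v → isBlock c′ zero v ≡ β v
  in₀′ v with β v
  ... | true  = refl
  ... | false = refl

  block-sym : ∀ s (d : Fin n → Fin 3) j u v → block s d j u v ≡ block s d j v u
  block-sym s d j u v = cong (s ∧_) (∧-comm (isBlock d j u) _)

  twists≡ : ∀ u v → twist e₂ B₀′ u v ≡ twist e (form p q t α β) u v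
  twists≡ u v = begin
    twist e₂ B₀′ u v
      ≡⟨ twist-twist (twist e B₀) B₁ B₀′ (block-sym t c (suc zero)) u v ⟩
    twist (twist e B₀) (λ u v → B₁ u v xor B₀′ u v) u v
      ≡⟨ twist-twist e B₀ (λ u v → B₁ u v xor B₀′ u v) (block-sym p c zero) u v ⟩
    twist e (λ u v → B₀ u v xor (B₁ u v xor B₀′ u v)) u v
      ≡⟨ twist-cong e (λ u v → cong₂ _xor_
            (cong (p ∧_) (cong₂ _∧_ (in₀ u) (in₀ v)))
            (trans (xor-comm (B₁ u v) (B₀′ u v)) (cong₂ _xor_
              (cong (q ∧_) (cong₂ _∧_ (in₀′ u) (in₀′ v)))
              (cong (t ∧_) (cong₂ _∧_ (in₁ u) (in₁ v)))))) u v ⟩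
    twist e (form p q t α β) u v ∎
    where open ≡-Reasoning

-- Decycling families as vectors

Rep : ∀ {n} → OrientedGraph n → ℕ → Set
Rep {n} D m = Σ[ x ∈ (Fin n → 𝔽₂^ m) ] Ordered (twist (arc D) λ u v → dot (x u) (x v))

incidence : ∀ {n m} → Vec (Subset n) m → Fin n → 𝔽₂^ m
incidence Xs u j = lookup (lookup Xs j) u

arc-invertAll : ∀ {n m} (D : OrientedGraph n) (Xs : Vec (Subset n) m) u v →
                arc (invertAll D Xs) u v ≡ twist (arc D) (λ u v → dot (incidence Xs u) (incidence Xs v)) u v
arc-invertAll D [] u v rewrite dot-[] (incidence [] u) (incidence [] v) = refl
arc-invertAll D (X ∷ Xs) u v
  rewrite arc-invertAll (invert D X) Xs u v
        | dot-∷ (incidence (X ∷ Xs) u) (incidence (X ∷ Xs) v)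
        | ∧-comm (lookup X v) (lookup X u)
  with lookup X u ∧ lookup X v | dot (incidence Xs u) (incidence Xs v)
... | true  | true  = refl
... | true  | false = refl
... | false | true  = refl
... | false | false = refl

decycling⇒rep : ∀ {n m} (D : OrientedGraph n) → ∃[ Xs ] Decycling {m = m} D Xs → Rep D m
decycling⇒rep D (Xs , acyclic) =
  incidence Xs , Ordered-cong (arc-invertAll D Xs) (acyclic⇒ordered _ acyclic)

rep⇒decycling : ∀ {n m} (D : OrientedGraph n) → Rep D m → ∃[ Xs ] Decycling {m = m} D Xs
rep⇒decycling {n} {m} D (x , ord) =
  Xs , ordered⇒acyclic _ (Ordered-cong (λ u v → sym (trans (arc-invertAll D Xs u v)
         (twist-cong (arc D) (λ u v → dot-cong (incidence≡ u) (incidence≡ v)) u v))) ord)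
  where
  Xs = tabulate λ j → tabulate λ u → x u j
  incidence≡ : ∀ u j → incidence Xs u j ≡ x u j
  incidence≡ u j = trans
    (cong (λ X → lookup X u) (lookup∘tabulate (λ j → tabulate λ u → x u j) j))
    (lookup∘tabulate (λ u → x u j) u)

rep-gram : ∀ {n M} (D : OrientedGraph n) {G : ArcMatrix n} → Gram M G → Ordered (twist (arc D) G) → Rep D M
rep-gram D (y , y≡) ord = y , Ordered-cong (λ u v → sym (twist-cong (arc D) y≡ u v)) ord

-- Representations of dijoins and their restrictions

⇒-arcˡʳ : ∀ {n₁ n₂} (D₁ : OrientedGraph n₁) (D₂ : OrientedGraph n₂) a v →
          arc (D₁ ⇒ D₂) (a ↑ˡ n₂) (n₁ ↑ʳ v) ≡ true
⇒-arcˡʳ {n₁} {n₂} D₁ D₂ a v rewrite Finₚ.splitAt-↑ˡ n₁ a n₂ | Finₚ.splitAt-↑ʳ n₁ n₂ v = refl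

⇒-arcˡˡ : ∀ {n₁ n₂} (D₁ : OrientedGraph n₁) (D₂ : OrientedGraph n₂) a b →
          arc (D₁ ⇒ D₂) (a ↑ˡ n₂) (b ↑ˡ n₂) ≡ arc D₁ a b
⇒-arcˡˡ {n₁} {n₂} D₁ D₂ a b rewrite Finₚ.splitAt-↑ˡ n₁ a n₂ | Finₚ.splitAt-↑ˡ n₁ b n₂ = refl

⇒-arcʳʳ : ∀ {n₁ n₂} (D₁ : OrientedGraph n₁) (D₂ : OrientedGraph n₂) u v →
          arc (D₁ ⇒ D₂) (n₁ ↑ʳ u) (n₁ ↑ʳ v) ≡ arc D₂ u v
⇒-arcʳʳ {n₁} {n₂} D₁ D₂ u v rewrite Finₚ.splitAt-↑ʳ n₁ n₂ u | Finₚ.splitAt-↑ʳ n₁ n₂ v = refl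

-- Orthogonality leaves every arc between the two sides in place, so all ranks of `D₁` can be put
-- below all ranks of `D₂`.
join-rep : ∀ {n₁ n₂ m} (D₁ : OrientedGraph n₁) (D₂ : OrientedGraph n₂)
           ((x , _) : Rep D₁ m) ((y , _) : Rep D₂ m) →
           (∀ a v → dot (x a) (y v) ≡ false) → Rep (D₁ ⇒ D₂) m
join-rep {n₁} {n₂} {m} D₁ D₂ (x , N₁ , r₁ , mono₁) (y , N₂ , r₂ , mono₂) x⊥y =
  z ∘ splitAt n₁ , N₁ + N₂ , r ∘ splitAt n₁ , mono
  where
  z : Fin n₁ ⊎ Fin n₂ → 𝔽₂^ m
  z = [ x , y ]
  r : Fin n₁ ⊎ Fin n₂ → Fin (N₁ + N₂)
  r = [ (λ a → r₁ a ↑ˡ N₂) , (λ v → N₁ ↑ʳ r₂ v) ]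
  mono : ∀ u v → T (twist (arc (D₁ ⇒ D₂)) (λ u v → dot (z (splitAt n₁ u)) (z (splitAt n₁ v))) u v) →
         r (splitAt n₁ u) Fin.< r (splitAt n₁ v)
  mono u v t with splitAt n₁ u | splitAt n₁ v
  ... | inj₁ a | inj₁ b rewrite Finₚ.toℕ-↑ˡ (r₁ a) N₂ | Finₚ.toℕ-↑ˡ (r₁ b) N₂ = mono₁ a b t
  ... | inj₁ a | inj₂ v rewrite Finₚ.toℕ-↑ˡ (r₁ a) N₂ | Finₚ.toℕ-↑ʳ N₁ (r₂ v) =
    ℕₚ.<-≤-trans (Finₚ.toℕ<n (r₁ a)) (ℕₚ.m≤m+n N₁ _)
  ... | inj₂ v | inj₁ a rewrite dot-comm (y v) (x a) | x⊥y a v = ⊥-elim t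
  ... | inj₂ u | inj₂ v rewrite Finₚ.toℕ-↑ʳ N₁ (r₂ u) | Finₚ.toℕ-↑ʳ N₁ (r₂ v) =
    ℕₚ.+-monoʳ-< N₁ (mono₂ u v t)

module DijoinRep {n₁ n₂ m} (D₁ : OrientedGraph n₁) (D₂ : OrientedGraph n₂)
                 (R : Rep (D₁ ⇒ D₂) m) where
  z : Fin (n₁ + n₂) → 𝔽₂^ m
  z = proj₁ R
  N : ℕ
  N = proj₁ (proj₂ R)
  r : Fin (n₁ + n₂) → Fin N
  r = proj₁ (proj₂ (proj₂ R))
  mono : ∀ u v → T (twist (arc (D₁ ⇒ D₂)) (λ u v → dot (z u) (z v)) u v) → r u Fin.< r v
  mono = proj₂ (proj₂ (proj₂ R))

  x : Fin n₁ → 𝔽₂^ m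
  x a = z (a ↑ˡ n₂)
  y : Fin n₂ → 𝔽₂^ m
  y v = z (n₁ ↑ʳ v)

  repˡ : Rep D₁ m
  repˡ = x , N , r ∘ (_↑ˡ n₂) , λ a b t → mono _ _ (subst T (sym (cong₂ (if_then_else_ (dot (x a) (x b)))
           (⇒-arcˡˡ D₁ D₂ b a) (⇒-arcˡˡ D₁ D₂ a b))) t)

  repʳ : Rep D₂ m
  repʳ = y , N , r ∘ (n₁ ↑ʳ_) , λ u v t → mono _ _ (subst T (sym (cong₂ (if_then_else_ (dot (y u) (y v)))
           (⇒-arcʳʳ D₁ D₂ v u) (⇒-arcʳʳ D₁ D₂ u v))) t)

  before : ∀ a v → dot (x a) (y v) ≡ true → r (n₁ ↑ʳ v) Fin.< r (a ↑ˡ n₂)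
  before a v av = mono _ _ (subst T (sym arc≡) _)
    where
    arc≡ : twist (arc (D₁ ⇒ D₂)) (λ u v → dot (z u) (z v)) (n₁ ↑ʳ v) (a ↑ˡ n₂) ≡ true
    arc≡ rewrite dot-comm (y v) (x a) | av = ⇒-arcˡʳ D₁ D₂ a v

  after : ∀ a v → dot (x a) (y v) ≡ false → r (a ↑ˡ n₂) Fin.< r (n₁ ↑ʳ v)
  after a v av = mono _ _ (subst T (sym arc≡) _)
    where
    arc≡ : twist (arc (D₁ ⇒ D₂)) (λ u v → dot (z u) (z v)) (a ↑ˡ n₂) (n₁ ↑ʳ v) ≡ true
    arc≡ rewrite av = ⇒-arcˡʳ D₁ D₂ a v

  -- If `v` comes before `b`, then `u`, which is not after `v`, comes before `a`, which is not
  -- before `b`. The case a = b shows that each functional cuts out an initial segment of `D₂`; the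
  -- case u = v shows that these segments are nested.
  closed : ∀ a u b v → r (n₁ ↑ʳ u) Fin.≤ r (n₁ ↑ʳ v) → r (b ↑ˡ n₂) Fin.≤ r (a ↑ˡ n₂) →
           T (dot (x b) (y v)) → T (dot (x a) (y u))
  closed a u b v u≤v b≤a bv with dot (x a) (y u) in au | dot (x b) (y v) in bv′
  ... | true  | _    = _
  ... | false | true = ℕₚ.<-irrefl refl (ℕₚ.<-≤-trans (after a u au)
                         (ℕₚ.≤-trans u≤v (ℕₚ.≤-trans (ℕₚ.<⇒≤ (before b v bv′)) b≤a)))

  -- The initial segments belonging to `a` and `b` are nested according to the ranks of `a` and `b`;
  -- `form-swap` handles the reverse inclusion.
  ordered-form : ∀ a b p q t →
    Ordered (twist (arc D₂) λ u v → dot (y u) (y v) xor form p q t (dot (x a) ∘ y) (dot (x b) ∘ y) u v)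
  ordered-form a b p q t =
    Ordered-cong (twist-twist (arc D₂) (λ u v → dot (y u) (y v)) _ λ u v → dot-comm (y u) (y v)) twisted
    where
    e = twist (arc D₂) λ u v → dot (y u) (y v)
    down : ∀ a u v → T (e u v) → T (dot (x a) (y v)) → T (dot (x a) (y u))
    down a u v u→v = closed a u a v (ℕₚ.<⇒≤ (proj₂ (proj₂ (proj₂ repʳ)) u v u→v)) ℕₚ.≤-refl
    twisted : Ordered (twist e (form p q t (dot (x a) ∘ y) (dot (x b) ∘ y)))
    twisted with ℕₚ.≤-total (toℕ (r (a ↑ˡ n₂))) (toℕ (r (b ↑ˡ n₂)))
    ... | inj₁ a≤b = twist-form-nested _ _ p q t (down a) (down b)
                       (λ v → closed b v a v ℕₚ.≤-refl a≤b) (proj₂ repʳ)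
    ... | inj₂ b≤a = Ordered-cong (twist-cong e (form-swap p q t (dot (x a) ∘ y) (dot (x b) ∘ y)))
                       (twist-form-nested _ _ q p t (down b) (down a)
                         (λ v → closed a v b v ℕₚ.≤-refl b≤a) (proj₂ repʳ))

-- Representing the second factor in lower dimension

EvenRep : ∀ {n} → OrientedGraph n → ℕ → Set
EvenRep {n} D m = dot (𝟏 {m}) 𝟏 ≡ true ×
  Σ[ (y , _) ∈ Rep D m ] ∀ v → dot 𝟏 (y v) ≡ false

even-rep : ∀ {n m} (D : OrientedGraph n) {G : ArcMatrix n} →
           Even m G → Ordered (twist (arc D) G) → EvenRep D m
even-rep D E ord = odd , rep-gram D (y , gram≡) ord , y⊥𝟏
  where open Even E

data Shrunk {n} (D : OrientedGraph n) : ℕ → Set where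
  standard : ∀ {m} → Rep D m → Shrunk D (2 + m)
  even     : ∀ {m} → EvenRep D m → Shrunk D (1 + m)

complement-rep : ∀ {n m} (D : OrientedGraph n) {G : ArcMatrix n} →
                 Complement G m → Ordered (twist (arc D) G) → Shrunk D m
complement-rep D (standard y) ord = standard (rep-gram D y ord)
complement-rep D (even E)     ord = even (even-rep D E ord)

-- Since x_a · x_b is its own square, this says that the Gram determinant of every pair
-- vanishes.
Degenerate : ∀ {n m} → (Fin n → 𝔽₂^ m) → Set
Degenerate x = ∀ a b → dot (x a) (x b) ≡ dot (x a) (x a) ∧ dot (x b) (x b)

degenerate? : ∀ {n m} (x : Fin n → 𝔽₂^ m) →
              (∃[ a ] ∃[ b ] dot (x a) (x b) ≢ dot (x a) (x a) ∧ dot (x b) (x b)) ⊎ Degenerate x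
degenerate? x with any? (λ a → any? (λ b → ¬? (dot (x a) (x b) ≟ (dot (x a) (x a) ∧ dot (x b) (x b)))))
... | yes pair = inj₁ pair
... | no ¬pair = inj₂ λ a b → decidable-stable (_ ≟ _) λ ≢ → ¬pair (a , b , ≢)

-- The Gram matrix is the outer product of the vector of norms with itself, so the norms alone, as
-- vectors of dimension 1, reverse the same arcs.
degenerate⇒rep₁ : ∀ {n m} (D : OrientedGraph n) ((x , _) : Rep D m) → Degenerate x → Rep D 1
degenerate⇒rep₁ D (x , ord) deg = rep-gram D (norm , gram≡) ord
  where
  norm : Fin _ → 𝔽₂^ 1
  norm a _ = dot (x a) (x a)
  gram≡ : ∀ a b → dot (norm a) (norm b) ≡ dot (x a) (x b)
  gram≡ a b rewrite dot-∷ (norm a) (norm b) | dot-[] (norm a ∘ suc) (norm b ∘ suc) | deg a b = xor-identityʳ _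

shrink₂ : ∀ {n₁ n₂ m} (D₁ : OrientedGraph n₁) (D₂ : OrientedGraph n₂) (R : Rep (D₁ ⇒ D₂) m) →
          let open DijoinRep D₁ D₂ R in
          ∀ a b → dot (x a) (x b) ≢ dot (x a) (x a) ∧ dot (x b) (x b) → Shrunk D₂ m
shrink₂ D₁ D₂ R a b det =
  let p , q , t , C = project y (x a) (x b) det in complement-rep D₂ C (ordered-form a b p q t)
  where open DijoinRep D₁ D₂ R

shrink₁ : ∀ {n₁ n₂ m} (D₁ : OrientedGraph n₁) (D₂ : OrientedGraph n₂) (R : Rep (D₁ ⇒ D₂) m) →
          let open DijoinRep D₁ D₂ R in
          ∀ a → dot (x a) (x a) ≡ true → (∃[ l ] m ≡ suc l × Rep D₂ l) ⊎ EvenRep D₂ m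
shrink₁ {m = zero}  D₁ D₂ R a aa = contradiction (trans (sym aa) (dot-[] (x a) (x a))) λ ()
  where open DijoinRep D₁ D₂ R
shrink₁ {m = suc m} D₁ D₂ R a aa =
  Sum.map (λ G → m , refl , rep-gram D₂ G ord) (λ E → even-rep D₂ E ord) (project₁ y (x a) aa)
  where
  open DijoinRep D₁ D₂ R
  ord = ordered-form a a true false false

-- Building representations from unit vectors

scale : ∀ {m} → Bool → 𝔽₂^ m → 𝔽₂^ m
scale s w = 𝟎 +[ s ] w

dot-scaleˡ : ∀ {m} s (w z : 𝔽₂^ m) → dot (scale s w) z ≡ s ∧ dot w z
dot-scaleˡ s w z rewrite dot-+ˡ 𝟎 s w z | dot-𝟎ˡ z = refl

dot-scale : ∀ {m} s t (w : 𝔽₂^ m) → dot w w ≡ true → dot (scale s w) (scale t w) ≡ s ∧ t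
dot-scale s t w ww rewrite dot-scaleˡ s w (scale t w) | dot-comm w (scale t w) | dot-scaleˡ t w w | ww =
  cong (s ∧_) (∧-identityʳ t)

-- Giving `w` to vertices 0 and 1 only reverses the single arc between them, and the order becomes
-- 1, 2, 0.
C⃗₃-rep : ∀ {m} (w : 𝔽₂^ m) → dot w w ≡ true → Rep C⃗₃ m
C⃗₃-rep {m} w ww = (λ a → scale (s a) w) , 3 , rank , mono
  where
  s : Fin 3 → Bool
  s zero             = true
  s (suc zero)       = true
  s (suc (suc zero)) = false
  rank : Fin 3 → Fin 3
  rank zero             = suc (suc zero)
  rank (suc zero)       = zero
  rank (suc (suc zero)) = suc zero
  mono : ∀ u v → T (twist (arc C⃗₃) (λ u v → dot (scale (s u) w) (scale (s v) w)) u v) → rank u Fin.< rank v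
  mono u v t rewrite dot-scale (s u) (s v) w ww = check u v t
    where
    check : ∀ u v → T (twist (arc C⃗₃) (λ u v → s u ∧ s v) u v) → rank u Fin.< rank v
    check zero             zero             ()
    check zero             (suc zero)       ()
    check zero             (suc (suc zero)) ()
    check (suc zero)       zero             _ = s≤s z≤n
    check (suc zero)       (suc zero)       ()
    check (suc zero)       (suc (suc zero)) _ = s≤s z≤n
    check (suc (suc zero)) zero             _ = s≤s (s≤s z≤n)
    check (suc (suc zero)) (suc zero)       ()
    check (suc (suc zero)) (suc (suc zero)) ()

C⃗₃-join : ∀ {n m} (D : OrientedGraph n) → EvenRep D m → Rep (C⃗₃ ⇒ D) m
C⃗₃-join D (odd , R@(y , _) , 𝟏⊥y) =
  join-rep C⃗₃ D (C⃗₃-rep 𝟏 odd) R λ a v → trans (dot-scaleˡ _ 𝟏 (y v)) (trans (cong (_ ∧_) (𝟏⊥y v)) (∧-zeroʳ _))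

C⃗₃-not-ordered : ¬ Ordered (arc C⃗₃)
C⃗₃-not-ordered (_ , r , mono) =
  ℕₚ.<-irrefl refl (ℕₚ.<-trans (mono zero (suc zero) _)
    (ℕₚ.<-trans (mono (suc zero) (suc (suc zero)) _) (mono (suc (suc zero)) zero _)))

rep-∷𝟎 : ∀ {n m} (D : OrientedGraph n) (R : Rep D m) → Rep D (suc m)
rep-∷𝟎 D (y , ord) = rep-gram D ((λ v → false VF.∷ y v) , λ u v → dot-∷ (false VF.∷ y u) (false VF.∷ y v)) ord

-- One new coordinate vector together with `w` forms an orthonormal pair orthogonal to the vectors
-- of `D₂`, and this pair carries an isometric copy of the plane in which `D₁` lives.
join-unit : ∀ {n₁ n₂ m} (D₁ : OrientedGraph n₁) (D₂ : OrientedGraph n₂) → Rep D₁ 2 →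
            (w : 𝔽₂^ m) → dot w w ≡ true →
            ((y , _) : Rep D₂ m) → (∀ v → dot w (y v) ≡ false) → Rep (D₁ ⇒ D₂) (suc m)
join-unit {n₁} {m = m} D₁ D₂ (x , ord) w ww R@(y , _) w⊥y =
  join-rep D₁ D₂ (rep-gram D₁ (x′ , gram) ord) (rep-∷𝟎 D₂ R) x′⊥
  where
  x′ : Fin n₁ → 𝔽₂^ (suc m)
  x′ a = x a zero VF.∷ scale (x a (suc zero)) w
  gram : ∀ a b → dot (x′ a) (x′ b) ≡ dot (x a) (x b)
  gram a b
    rewrite dot-∷ (x′ a) (x′ b) | dot-scale (x a (suc zero)) (x b (suc zero)) w ww
          | dot-∷ (x a) (x b) | dot-∷ (x a ∘ suc) (x b ∘ suc) =
    cong ((x a zero ∧ x b zero) xor_)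
      (sym (trans (cong ((x a (suc zero) ∧ x b (suc zero)) xor_) (dot-[] _ _)) (xor-identityʳ _)))
  x′⊥ : ∀ a v → dot (x′ a) (false VF.∷ y v) ≡ false
  x′⊥ a v rewrite dot-∷ (x′ a) (false VF.∷ y v) | dot-scaleˡ (x a (suc zero)) w (y v) | w⊥y v
                | ∧-zeroʳ (x a zero) = ∧-zeroʳ _

join-rep₂ : ∀ {n₁ n₂ m} (D₁ : OrientedGraph n₁) (D₂ : OrientedGraph n₂) →
            Rep D₁ 2 → Rep D₂ m → Rep (D₁ ⇒ D₂) (2 + m)
join-rep₂ D₁ D₂ R₁ R₂ = join-unit D₁ D₂ R₁ 𝐞 (dot-𝐞 𝐞) (rep-∷𝟎 D₂ R₂) λ v → dot-𝐞 (false VF.∷ proj₁ R₂ v)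

-- Lower bounds and the theorem

module _ {n₂} (D₂ : OrientedGraph n₂) {k} (minimal : ∀ m → Rep D₂ m → k ℕ.≤ m) where

  -- Some pair in `D₁` is nondegenerate, since one set does not decycle `D₁`. Shrinking along it
  -- costs two dimensions, or only one in the even case. The bound 2 + k can then fail only if the
  -- even vectors live in dimension exactly `k`, which makes `k` odd.
  dijoin-bound : ∀ {n₁ m} (D₁ : OrientedGraph n₁) → ¬ Rep D₁ 1 → Rep (D₁ ⇒ D₂) m →
                 2 + k ℕ.≤ m ⊎ (m ≡ suc k × k % 2 ≡ 1 × Rep (C⃗₃ ⇒ D₂) k)
  dijoin-bound D₁ ¬rep₁ R with degenerate? (DijoinRep.x D₁ D₂ R)
  ... | inj₂ deg = contradiction (degenerate⇒rep₁ D₁ (DijoinRep.repˡ D₁ D₂ R) deg) ¬rep₁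
  ... | inj₁ (a , b , det) with shrink₂ D₁ D₂ R a b det
  ...   | standard R₂ = inj₁ (s≤s (s≤s (minimal _ R₂)))
  ...   | even E@(odd , R₂ , _) with ℕₚ.m≤n⇒m<n∨m≡n (minimal _ R₂)
  ...     | inj₁ k<m  = inj₁ (s≤s k<m)
  ...     | inj₂ refl = inj₂ (refl , dot-𝟏𝟏⇒odd k odd , C⃗₃-join D₂ E)

  not-shrunk : ¬ Shrunk D₂ k
  not-shrunk S = too-small S refl
    where
    too-small : ∀ {m} → Shrunk D₂ m → m ≢ k
    too-small (standard R)       refl = ℕₚ.<⇒≱ (ℕₚ.m<n+m _ (s≤s z≤n)) (minimal _ R)
    too-small (even (_ , R , _)) refl = ℕₚ.1+n≰n (minimal _ R)

  -- A nondegenerate pair in the triangle would represent `D₂` in dimension below `k`. In the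
  -- degenerate case a vertex of norm 1 can be projected away, where minimality leaves only the even
  -- outcome. If all norms vanish, so do all products, and the triangle would be acyclic as it
  -- stands.
  C⃗₃-even : Rep (C⃗₃ ⇒ D₂) k → EvenRep D₂ k
  C⃗₃-even R with degenerate? x | any? (λ a → dot (x a) (x a) ≟ true)
    where open DijoinRep C⃗₃ D₂ R
  ... | inj₁ (a , b , det) | _            = contradiction (shrink₂ C⃗₃ D₂ R a b det) not-shrunk
  ... | inj₂ deg           | yes (a , aa) =
    [ (λ (_ , k≡1+m , R′) → contradiction R′ (not-rep k≡1+m)) , id ] (shrink₁ C⃗₃ D₂ R a aa)
    where
    not-rep : ∀ {m} → k ≡ suc m → ¬ Rep D₂ m
    not-rep refl R′ = ℕₚ.1+n≰n (minimal _ R′)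
  ... | inj₂ deg           | no ¬norm₁    =
    contradiction (Ordered-cong (twist-cong (arc C⃗₃) gram₀) (proj₂ repˡ)) C⃗₃-not-ordered
    where
    open DijoinRep C⃗₃ D₂ R
    gram₀ : ∀ a b → dot (x a) (x b) ≡ false
    gram₀ a b = trans (deg a b) (cong (_∧ dot (x b) (x b)) (¬-not λ aa → ¬norm₁ (a , aa)))

theorem1p1 : ∀ {n₁ n₂ : ℕ} (D₁ : OrientedGraph n₁) (D₂ : OrientedGraph n₂) (k : ℕ) →
    Inv D₁ ≔ 2 → Inv D₂ ≔ k →
    ((Inv D₁ ⇒ D₂ ≔ k + 2) ⊎ ((Inv D₁ ⇒ D₂ ≔ k + 1) × (k % 2 ≡ 1)))
    × ((Inv D₁ ⇒ D₂ ≔ k + 1) ⇔ (Inv C⃗₃ ⇒ D₂ ≔ k))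
theorem1p1 D₁ D₂ k (dec₁ , min₁) (dec₂ , min₂)
  rewrite ℕₚ.+-comm k 2 | ℕₚ.+-comm k 1 = alternatives , mk⇔ C⃗₃-drop C⃗₃-lift
  where
  R₁ : Rep D₁ 2
  R₁ = decycling⇒rep D₁ dec₁

  ¬rep₁ : ¬ Rep D₁ 1
  ¬rep₁ R = ℕₚ.1+n≰n (uncurry (min₁ 1) (rep⇒decycling D₁ R))

  minimal : ∀ m → Rep D₂ m → k ℕ.≤ m
  minimal m R = uncurry (min₂ m) (rep⇒decycling D₂ R)

  bound : ∀ {m} → ∃[ Xs ] Decycling {m = m} (D₁ ⇒ D₂) Xs →
          2 + k ℕ.≤ m ⊎ (m ≡ suc k × k % 2 ≡ 1 × Rep (C⃗₃ ⇒ D₂) k)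
  bound dec = dijoin-bound D₂ minimal D₁ ¬rep₁ (decycling⇒rep (D₁ ⇒ D₂) dec)

  suc-k≤ : ∀ m (Xs : Vec _ m) → Decycling (D₁ ⇒ D₂) Xs → suc k ℕ.≤ m
  suc-k≤ m Xs acyclic with bound (Xs , acyclic)
  ... | inj₁ 2+k≤m      = ℕₚ.<⇒≤ 2+k≤m
  ... | inj₂ (refl , _) = ℕₚ.≤-refl

  alternatives : (Inv D₁ ⇒ D₂ ≔ 2 + k) ⊎ ((Inv D₁ ⇒ D₂ ≔ 1 + k) × (k % 2 ≡ 1))
  -- If k + 1 sets do not suffice, the exceptional case of `bound` is excluded and the generic upper
  -- bound k + 2 is attained.
  alternatives with decyclable? (D₁ ⇒ D₂) (suc k)
  ... | no ¬dec = inj₁ (rep⇒decycling (D₁ ⇒ D₂) (join-rep₂ D₁ D₂ R₁ (decycling⇒rep D₂ dec₂)) , 2+k≤)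
    where
    2+k≤ : ∀ m (Xs : Vec _ m) → Decycling (D₁ ⇒ D₂) Xs → 2 + k ℕ.≤ m
    2+k≤ m Xs acyclic with bound (Xs , acyclic)
    ... | inj₁ 2+k≤m      = 2+k≤m
    ... | inj₂ (refl , _) = contradiction (Xs , acyclic) ¬dec
  ... | yes dec with bound dec
  ...   | inj₁ 2+k≤1+k       = contradiction 2+k≤1+k ℕₚ.1+n≰n
  ...   | inj₂ (_ , odd , _) = inj₂ ((dec , suc-k≤) , odd)

  C⃗₃-drop : Inv D₁ ⇒ D₂ ≔ suc k → Inv C⃗₃ ⇒ D₂ ≔ k
  C⃗₃-drop (dec , _) with bound dec
  ... | inj₁ 2+k≤1+k     = contradiction 2+k≤1+k ℕₚ.1+n≰n
  ... | inj₂ (_ , _ , R) = rep⇒decycling (C⃗₃ ⇒ D₂) R ,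
    -- Restricting a family to the induced copy of `D₂` gives the lower bound `k`.
    λ m Xs acyclic → minimal m (DijoinRep.repʳ C⃗₃ D₂ (decycling⇒rep (C⃗₃ ⇒ D₂) (Xs , acyclic)))

  C⃗₃-lift : Inv C⃗₃ ⇒ D₂ ≔ k → Inv D₁ ⇒ D₂ ≔ suc k
  C⃗₃-lift (dec , _) with C⃗₃-even D₂ minimal (decycling⇒rep (C⃗₃ ⇒ D₂) dec)
  -- The unit vector orthogonal to the even vectors is `𝟏`, of norm 1 in odd dimension, so one extra
  -- dimension makes room for `D₁`.
  ... | odd , R₂ , 𝟏⊥y = rep⇒decycling (D₁ ⇒ D₂) (join-unit D₁ D₂ R₁ 𝟏 odd R₂ 𝟏⊥y) , suc-k≤
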